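{- Let $R$ be a Dedekind domain, let $P$ be a nonzero prime ideal of $R$ such that $R/P$ is finite, and let $r$ and $\alpha$ be positive integers. Then \[\mathscr{S}_r(R/P^{\alpha})=\begin{cases} |R/P|^{\alpha-1}(|R/P|-r), & \text{if } r\leq \operatorname{char}(R/P);\\ |R/P|^{\alpha-1}(|R/P|-\operatorname{char}(R/P)), & \text{if } r>\operatorname{char}(R/P).\end{cases}\]
   Context: For an ideal $I$ of a Dedekind domain $R$ with $R/I$ finite and a positive integer $r$, define $L_r(R/I)=\{a+I\in R/I : a+i+I\in U(R/I)\text{ for all } i\in\{0,1,\ldots,r-1\}\}$, where $U(\cdot)$ denotes the group of units and an integer $i$ is viewed as the element $1+1+\cdots+1$ ($i$ times) of $R$. Set $\mathscr{S}_r(R/I)=|L_r(R/I)|$. $\operatorname{char}(X)$ denotes the characteristic of a ring $X$. -}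

module Defs where

open import Level using (Level; _⊔_; suc; Lift)
open import Algebra.Bundles using (CommutativeRing)
open import Data.Nat as ℕ using (ℕ; zero; _<_)
open import Data.Fin using (Fin)
open import Data.List using (List; []; _∷_; length)
open import Data.List.Relation.Unary.All using (All)
open import Data.Product using (Σ; ∃; _×_; _,_)
open import Data.Sum using (_⊎_)
open import Data.Unit.Polymorphic using (⊤)
open import Relation.Nullary using (¬_)
open import Relation.Binary.PropositionalEquality using (_≡_)

module _ {c ℓ : Level} (R : CommutativeRing c ℓ) where
  open CommutativeRing R renaming (Carrier to A)

  Pred : Set (suc (c ⊔ ℓ))
  Pred = A → Set (c ⊔ ℓ)

  ι : ℕ → A
  ι zero = 0#
  ι (ℕ.suc n) = 1# + ι n

  _^ᴿ_ : A → ℕ → A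
  x ^ᴿ zero = 1#
  x ^ᴿ ℕ.suc n = x * (x ^ᴿ n)

  record Ideal : Set (suc (c ⊔ ℓ)) where
    field
      mem     : Pred
      resp    : ∀ {x y} → x ≈ y → mem x → mem y
      zero∈   : mem 0#
      +-closed : ∀ {x y} → mem x → mem y → mem (x + y)
      *-closed : ∀ r {x} → mem x → mem (r * x)
  open Ideal public

  IsNonzero : Ideal → Set (c ⊔ ℓ)
  IsNonzero I = ∃ λ x → mem I x × ¬ (x ≈ 0#)

  IsPrimeIdeal : Ideal → Set (c ⊔ ℓ)
  IsPrimeIdeal I = ¬ mem I 1# × (∀ x y → mem I (x * y) → mem I x ⊎ mem I y)

  IsMaximalIdeal : Ideal → Set (suc (c ⊔ ℓ))
  IsMaximalIdeal I = ¬ mem I 1#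
    × (∀ (J : Ideal) → (∀ x → mem I x → mem J x) → (∃ λ x → mem J x × ¬ mem I x) → mem J 1#)

  Span : List A → A → Set (c ⊔ ℓ)
  Span [] x = Lift c (x ≈ 0#)
  Span (g ∷ gs) x = ∃ λ a → ∃ λ y → Span gs y × x ≈ a * g + y

  FinitelyGenerated : Ideal → Set (c ⊔ ℓ)
  FinitelyGenerated I = ∃ λ gs → ∀ x → (mem I x → Span gs x) × (Span gs x → mem I x)

  -- homogenised monic polynomial: for cs = [c₀,…,c_{n-1}],
  -- hom cs a b = aⁿ + c_{n-1} a^{n-1} b + … + c₀ bⁿ
  -- (so b ≠ 0 and hom cs a b = 0 means a/b is a root of a monic polynomial over R)
  hom : List A → A → A → A
  hom [] a b = 1#
  hom (k ∷ ks) a b = k * (b ^ᴿ ℕ.suc (length ks)) + a * hom ks a b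

  record IsDedekindDomain : Set (suc (c ⊔ ℓ)) where
    field
      1≉0 : ¬ (1# ≈ 0#)
      noZeroDivisors : ∀ x y → x * y ≈ 0# → x ≈ 0# ⊎ y ≈ 0#
      noetherian : ∀ (I : Ideal) → FinitelyGenerated I
      integrallyClosed : ∀ a b → ¬ (b ≈ 0#) → (ks : List A) → hom ks a b ≈ 0#
                         → ∃ λ x → a ≈ x * b
      nonzeroPrime⇒maximal : ∀ (P : Ideal) → IsPrimeIdeal P → IsNonzero P → IsMaximalIdeal P

  sumProd : List (A × A) → A
  sumProd [] = 0#
  sumProd ((a , b) ∷ ps) = a * b + sumProd ps

  _·ᴵ_ : Pred → Pred → Pred
  (I ·ᴵ J) x = ∃ λ (ps : List (A × A)) →
    All (λ p → I (Data.Product.proj₁ p) × J (Data.Product.proj₂ p)) ps × x ≈ sumProd ps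

  _^ᴵ_ : Pred → ℕ → Pred
  I ^ᴵ zero = λ _ → ⊤
  I ^ᴵ ℕ.suc n = I ·ᴵ (I ^ᴵ n)

  _≡[_]_ : A → Pred → A → Set (c ⊔ ℓ)
  x ≡[ I ] y = I (x + - y)

  IsUnitMod : Pred → A → Set (c ⊔ ℓ)
  IsUnitMod I x = ∃ λ y → (x * y) ≡[ I ] 1#

  -- L_r(R/I), as a subset of representatives in R
  L : ℕ → Pred → Pred
  L r I a = ∀ (i : ℕ) → i < r → IsUnitMod I (a + ι i)

  -- The subset S of R/I (given by representatives; S assumed stable under ≡ mod I)
  -- has exactly n elements: an injective, surjective enumeration Fin n → S/≡[I].
  HasSizeMod : Pred → Pred → ℕ → Set (c ⊔ ℓ)
  HasSizeMod I S n = Σ (Fin n → A) λ f →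
      (∀ k → S (f k))
    × (∀ j k → f j ≡[ I ] f k → j ≡ k)
    × (∀ a → S a → ∃ λ k → a ≡[ I ] f k)

  CharMod : Pred → ℕ → Set (c ⊔ ℓ)
  CharMod I zero = ∀ m → 0 < m → ¬ I (ι m)
  CharMod I (ℕ.suc n) = I (ι (ℕ.suc n)) × (∀ m → 0 < m → m < ℕ.suc n → ¬ I (ι m))

{-# OPTIONS --safe #-}
module Submission where

-- If (a : b) = P for some 0 ≠ a ∈ P, the ideal (b/a)P is not contained in P,
-- because b/a would then be integral; so π b = a s with π ∈ P and s ∉ P, whence s P ⊆ (π). Therefore
-- t ↦ πᵏ t induces isomorphisms R/P → Pᵏ/Pᵏ⁺¹, and every class mod P splits into |R/P|^(α−1) classes mod P^α.
-- Units mod P^α are the elements outside P, so a lies in L_r iff its residue avoids 0, −1, …, −(r−1), which are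
-- distinct for r ≤ char(R/P) and repeat with period char(R/P).

open import Defs
open import Level using (Level; _⊔_; lift; lower)
open import Algebra.Bundles using (CommutativeRing)
import Algebra.Properties.CommutativeSemigroup as CommutativeSemigroupProperties
import Algebra.Properties.Ring as RingProperties
import Algebra.Solver.Ring.NaturalCoefficients.Default as NatSolver
open import Data.Nat as ℕ using (ℕ; zero; suc; s≤s)
open import Data.Nat.DivMod using (_/_; _%_; m%n<n; m≡m%n+[m/n]*n)
import Data.Nat.Properties as ℕₚ
open import Data.List using (List; []; _∷_; length; applyUpTo)
open import Data.List.Relation.Unary.All as All using (All; []; _∷_)
open import Data.Fin as Fin using (Fin)
import Data.Fin.Properties as Finₚ
open import Data.Nat.GeneralisedArithmetic using (fold)
open import Data.Product using (Σ; ∃; ∃₂; _×_; _,_; proj₁; proj₂)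
open import Data.Sum using (_⊎_; inj₁; inj₂; [_,_]′)
open import Data.Unit.Polymorphic using (⊤)
open import Data.Empty using (⊥-elim)
open import Function using (_∘_; id)
open import Relation.Nullary using (¬_)
open import Relation.Binary.PropositionalEquality as ≡ using (_≡_)
import Relation.Binary.Reasoning.Setoid as SetoidReasoning

module _ {c ℓ : Level} (R : CommutativeRing c ℓ) where
  open CommutativeRing R renaming (Carrier to A) hiding (_-_; zero)
  open RingProperties ring
  open CommutativeSemigroupProperties *-commutativeSemigroup
    using (x∙yz≈xz∙y; x∙yz≈y∙xz; x∙yz≈y∙zx; x∙yz≈yx∙z; x∙yz≈z∙yx; interchange)
  open NatSolver commutativeSemiring
  open SetoidReasoning setoid

  -- Congruence modulo an ideal.

  infixr 8 _↑_
  _↑_ : A → ℕ → A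
  _↑_ = _^ᴿ_ R

  infix 4 _≋_mod_
  _≋_mod_ : A → A → Ideal R → Set (c ⊔ ℓ)
  x ≋ y mod I = _≡[_]_ R x (mem I) y

  infix 4 _⊆ᴵ_
  _⊆ᴵ_ : Ideal R → Ideal R → Set (c ⊔ ℓ)
  I ⊆ᴵ J = ∀ x → mem I x → mem J x

  x≈y+[x-y] : ∀ x y → x ≈ y + (x + - y)
  x≈y+[x-y] x y = begin
    x                ≈⟨ +-identityʳ x ⟨
    x + 0#           ≈⟨ +-congˡ (-‿inverseʳ y) ⟨
    x + (y + - y)    ≈⟨ solve 3 (λ x y m → x :+ (y :+ m) := y :+ (x :+ m)) refl x y (- y) ⟩
    y + (x + - y)    ∎

  neg-closed : (I : Ideal R) → ∀ {x} → mem I x → mem I (- x)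
  neg-closed I x∈I = resp I (-1*x≈-x _) (*-closed I (- 1#) x∈I)

  ≋-intro : (I : Ideal R) → ∀ {x y e} → x ≈ y + e → mem I e → x ≋ y mod I
  ≋-intro I {x} {y} {e} x≈y+e = resp I (+-cancelˡ y e (x + - y) (trans (sym x≈y+e) (x≈y+[x-y] x y)))

  ≋-elim : (I : Ideal R) → ∀ {x y} → x ≋ y mod I → ∃ λ e → mem I e × x ≈ y + e
  ≋-elim I {x} {y} x≋y = x + - y , x≋y , x≈y+[x-y] x y

  ≋-sym : (I : Ideal R) → ∀ {x y} → x ≋ y mod I → y ≋ x mod I
  ≋-sym I {x} {y} x≋y = resp I (⁻¹-anti-homo-// x y) (neg-closed I x≋y)

  ≋-trans : (I : Ideal R) → ∀ {x y z} → x ≋ y mod I → y ≋ z mod I → x ≋ z mod I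
  ≋-trans I {x} {y} {z} x≋y y≋z with ≋-elim I x≋y | ≋-elim I y≋z
  ... | d , d∈I , x≈y+d | e , e∈I , y≈z+e = ≋-intro I
    (trans x≈y+d (trans (+-congʳ y≈z+e) (+-assoc z e d))) (+-closed I e∈I d∈I)

  +-cancelˡ-mem : (I : Ideal R) → ∀ {x y} → mem I x → mem I (x + y) → mem I y
  +-cancelˡ-mem I {x} {y} x∈I x+y∈I =
    resp I (trans (solve 3 (λ x y m → m :+ (x :+ y) := (x :+ m) :+ y) refl x y (- x))
                  (trans (+-congʳ (-‿inverseʳ x)) (+-identityˡ y)))
           (+-closed I (neg-closed I x∈I) x+y∈I)

  -- Ideals spanned by finite lists.

  Span-zero : ∀ gs → Span R gs 0#
  Span-zero [] = lift refl
  Span-zero (g ∷ gs) = 0# , 0# , Span-zero gs , solve 1 (λ g → con 0 := con 0 :* g :+ con 0) refl g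

  Span-head : ∀ g gs → Span R (g ∷ gs) g
  Span-head g gs = 1# , 0# , Span-zero gs , trans (sym (*-identityˡ g)) (sym (+-identityʳ _))

  Span-tail : ∀ g gs {x} → Span R gs x → Span R (g ∷ gs) x
  Span-tail g gs {x} x∈gs = 0# , x , x∈gs , solve 2 (λ g x → x := con 0 :* g :+ x) refl g x

  Span-ideal : List A → Ideal R
  Span-ideal gs = record
    { mem = Span R gs ; resp = S-resp gs ; zero∈ = Span-zero gs ; +-closed = S-+ gs ; *-closed = S-* gs }
    where
    S-resp : ∀ gs {x y} → x ≈ y → Span R gs x → Span R gs y
    S-resp [] x≈y (lift x≈0) = lift (trans (sym x≈y) x≈0)
    S-resp (g ∷ gs) x≈y (a , z , z∈ , x≈) = a , z , z∈ , trans (sym x≈y) x≈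

    S-+ : ∀ gs {x y} → Span R gs x → Span R gs y → Span R gs (x + y)
    S-+ [] (lift x≈0) (lift y≈0) = lift (trans (+-cong x≈0 y≈0) (+-identityˡ 0#))
    S-+ (g ∷ gs) (a , u , u∈ , x≈) (b , v , v∈ , y≈) = a + b , u + v , S-+ gs u∈ v∈ ,
      trans (+-cong x≈ y≈)
        (solve 5 (λ a b g u v → (a :* g :+ u) :+ (b :* g :+ v) := (a :+ b) :* g :+ (u :+ v)) refl a b g u v)

    S-* : ∀ gs r {x} → Span R gs x → Span R gs (r * x)
    S-* [] r (lift x≈0) = lift (trans (*-congˡ x≈0) (zeroʳ r))
    S-* (g ∷ gs) r (a , u , u∈ , x≈) = r * a , r * u , S-* gs r u∈ ,
      trans (*-congˡ x≈) (solve 4 (λ r a g u → r :* (a :* g :+ u) := r :* a :* g :+ r :* u) refl r a g u)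

  Span-least : (I : Ideal R) → ∀ {gs} → All (mem I) gs → ∀ x → Span R gs x → mem I x
  Span-least I [] x (lift x≈0) = resp I (sym x≈0) (zero∈ I)
  Span-least I (g∈I ∷ gs⊆I) x (a , y , y∈gs , x≈) =
    resp I (sym x≈) (+-closed I (*-closed I a g∈I) (Span-least I gs⊆I y y∈gs))

  Span-applyUpTo-suc : ∀ f n {x} → Span R (applyUpTo f n) x → Span R (applyUpTo f (suc n)) x
  Span-applyUpTo-suc f zero x∈ = Span-tail (f 0) [] x∈
  Span-applyUpTo-suc f (suc n) (a , y , y∈ , x≈) = a , y , Span-applyUpTo-suc (f ∘ suc) n y∈ , x≈

  Span-applyUpTo-last : ∀ f n → Span R (applyUpTo f (suc n)) (f n)
  Span-applyUpTo-last f zero = Span-head (f 0) []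
  Span-applyUpTo-last f (suc n) = Span-tail (f 0) _ (Span-applyUpTo-last (f ∘ suc) n)

  -- Ideal quotients, products and powers.

  -- The annihilator of `b` in R/(d). In a domain with `b` nonzero it is the intersection of R with
  -- the fractional ideal generated by d/b.
  colon : A → A → Ideal R
  colon d b = record
    { mem = λ z → ∃ λ y → z * b ≈ d * y
    ; resp = λ { x≈y (t , eq) → t , trans (*-congʳ (sym x≈y)) eq }
    ; zero∈ = 0# , trans (zeroˡ b) (sym (zeroʳ d))
    ; +-closed = λ { {x} {y} (t , eq) (t′ , eq′) → t + t′ ,
        trans (distribʳ b x y) (trans (+-cong eq eq′) (sym (distribˡ d t t′))) }
    ; *-closed = λ { r {x} (t , eq) → r * t ,
        trans (*-assoc r x b) (trans (*-congˡ eq)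
          (solve 3 (λ r d t → r :* (d :* t) := d :* (r :* t)) refl r d t)) }
    }

  ·ᴵ-least : ∀ {I J : A → Set (c ⊔ ℓ)} (K : Ideal R) → (∀ {a b} → I a → J b → mem K (a * b)) →
             ∀ {x} → _·ᴵ_ R I J x → mem K x
  ·ᴵ-least {I} {J} K I·J⊆K (ps , ps∈ , x≈) = resp K (sym x≈) (go ps∈)
    where
    go : ∀ {ps} → All (λ p → I (proj₁ p) × J (proj₂ p)) ps → mem K (sumProd R ps)
    go [] = zero∈ K
    go ((a∈I , b∈J) ∷ ps∈) = +-closed K (I·J⊆K a∈I b∈J) (go ps∈)

  ·ᴵ-intro : ∀ {I J : A → Set (c ⊔ ℓ)} {a b} → I a → J b → _·ᴵ_ R I J (a * b)
  ·ᴵ-intro {a = a} {b} a∈I b∈J = (a , b) ∷ [] , (a∈I , b∈J) ∷ [] , sym (+-identityʳ _)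

  _·_ : Ideal R → Ideal R → Ideal R
  I · J = record
    { mem = _·ᴵ_ R (mem I) (mem J)
    ; resp = λ { x≈y (ps , ps∈ , x≈) → ps , ps∈ , trans (sym x≈y) x≈ }
    ; zero∈ = [] , [] , refl
    ; +-closed = λ { (ps , ps∈ , x≈) (qs , qs∈ , y≈) → add ps∈ x≈ qs∈ y≈ }
    ; *-closed = λ { r (ps , ps∈ , x≈) → scale r ps∈ x≈ }
    }
    where
    Terms : List (A × A) → Set (c ⊔ ℓ)
    Terms = All (λ p → mem I (proj₁ p) × mem J (proj₂ p))

    add : ∀ {ps qs x y} → Terms ps → x ≈ sumProd R ps → Terms qs → y ≈ sumProd R qs →
          _·ᴵ_ R (mem I) (mem J) (x + y)
    add [] x≈ qs∈ y≈ = _ , qs∈ , trans (+-cong x≈ y≈) (+-identityˡ _)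
    add (p∈ ∷ ps∈) x≈ qs∈ y≈ with add ps∈ refl qs∈ y≈
    ... | rs , rs∈ , eq = _ ∷ rs , p∈ ∷ rs∈ , trans (+-congʳ x≈) (trans (+-assoc _ _ _) (+-congˡ eq))

    scale : ∀ r {ps x} → Terms ps → x ≈ sumProd R ps → _·ᴵ_ R (mem I) (mem J) (r * x)
    scale r [] x≈ = [] , [] , trans (*-congˡ x≈) (zeroʳ r)
    scale r ((a∈I , b∈J) ∷ ps∈) x≈ with scale r ps∈ refl
    ... | rs , rs∈ , eq = _ ∷ rs , (*-closed I r a∈I , b∈J) ∷ rs∈ ,
      trans (*-congˡ x≈) (trans (distribˡ r _ _) (+-cong (sym (*-assoc r _ _)) eq))

  -- `_^ᴵ_` again, now bundled with the closure properties of an ideal.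
  pow : Ideal R → ℕ → Ideal R
  pow I zero = record
    { mem = λ _ → ⊤ ; resp = λ _ _ → _ ; zero∈ = _ ; +-closed = λ _ _ → _ ; *-closed = λ _ _ → _ }
  pow I (suc n) = I · pow I n

  -- An equality of predicates, so that counts modulo `pow I n` can be transported to `_^ᴵ_`; for a
  -- variable exponent the two do not reduce to one another.
  mem-pow : ∀ I n → mem (pow I n) ≡ _^ᴵ_ R (mem I) n
  mem-pow I zero = ≡.refl
  mem-pow I (suc n) = ≡.cong (_·ᴵ_ R (mem I)) (mem-pow I n)

  pow-suc⊆pow : ∀ I n → pow I (suc n) ⊆ᴵ pow I n
  pow-suc⊆pow I n x = ·ᴵ-least (pow I n) (λ {a} _ → *-closed (pow I n) a)

  pow-suc⊆ : ∀ I n → pow I (suc n) ⊆ᴵ I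
  pow-suc⊆ I n x = ·ᴵ-least I (λ {a} {b} a∈I _ → resp I (*-comm b a) (*-closed I b a∈I))

  ⊆pow-1 : ∀ I → I ⊆ᴵ pow I 1
  ⊆pow-1 I x x∈I = resp (pow I 1) (*-identityʳ x) (·ᴵ-intro x∈I _)

  ↑∈pow : ∀ I n {x} → mem I x → mem (pow I n) (x ↑ n)
  ↑∈pow I zero x∈I = _
  ↑∈pow I (suc n) x∈I = ·ᴵ-intro x∈I (↑∈pow I n x∈I)

  -- Images of the natural numbers, and monotone chains of ideals.

  ι-+ : ∀ m n → ι R (m ℕ.+ n) ≈ ι R m + ι R n
  ι-+ zero n = sym (+-identityˡ _)
  ι-+ (suc m) n = trans (+-congˡ (ι-+ m n)) (sym (+-assoc 1# _ _))

  ι-*∈ : ∀ (I : Ideal R) {p} → mem I (ι R p) → ∀ k → mem I (ι R (k ℕ.* p))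
  ι-*∈ I p∈I zero = zero∈ I
  ι-*∈ I {p} p∈I (suc k) = resp I (sym (ι-+ p (k ℕ.* p))) (+-closed I p∈I (ι-*∈ I p∈I k))

  chain-mono : (I : ℕ → Ideal R) → (∀ n → I n ⊆ᴵ I (suc n)) → ∀ {m n} → m ℕ.≤ n → I m ⊆ᴵ I n
  chain-mono I I-suc m≤n = go (ℕₚ.≤⇒≤′ m≤n)
    where
    go : ∀ {m n} → m ℕ.≤′ n → I m ⊆ᴵ I n
    go ℕ.≤′-refl x x∈ = x∈
    go (ℕ.≤′-step m≤n) x x∈ = I-suc _ x (go m≤n x x∈)

  -- Counting residue classes.

  HasSizeMod-cong : ∀ (I J : Ideal R) {S T : A → Set (c ⊔ ℓ)} {n} → I ⊆ᴵ J → J ⊆ᴵ I →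
                    (∀ x → S x → T x) → (∀ x → T x → S x) →
                    HasSizeMod R (mem I) S n → HasSizeMod R (mem J) T n
  HasSizeMod-cong I J I⇒J J⇒I S⇒T T⇒S (f , f∈S , f-inj , f-surj) =
    f , (λ k → S⇒T _ (f∈S k)) , (λ j k → f-inj j k ∘ J⇒I _) ,
    λ a a∈T → let k , a≋fk = f-surj a (T⇒S a a∈T) in k , I⇒J _ a≋fk

  HasSizeMod-remove : ∀ (I : Ideal R) {S : A → Set (c ⊔ ℓ)} {n s} → HasSizeMod R (mem I) S n → S s →
                      HasSizeMod R (mem I) (λ a → S a × ¬ a ≋ s mod I) (ℕ.pred n)
  HasSizeMod-remove I {S} {n} {s} (f , f∈S , f-inj , f-surj) s∈S with f-surj s s∈S
  -- The index `k` in `Fin n` rules out n = 0; the new enumeration skips `k`, the class of `s`.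
  HasSizeMod-remove I {S} {suc n} {s} (f , f∈S , f-inj , f-surj) s∈S | k , s≋fk =
    f ∘ Fin.punchIn k ,
    (λ j → f∈S _ , λ fj≋s → Finₚ.punchInᵢ≢i k j (f-inj _ k (≋-trans I {f (Fin.punchIn k j)} {s} {f k} fj≋s s≋fk))) ,
    (λ i j → Finₚ.punchIn-injective k i j ∘ f-inj _ _) ,
    λ { a (a∈S , a≉s) → surj a a≉s (f-surj a a∈S) }
    where
    surj : ∀ a → ¬ a ≋ s mod I → (∃ λ l → a ≋ f l mod I) → ∃ λ j → a ≋ f (Fin.punchIn k j) mod I
    surj a a≉s (l , a≋fl) = Fin.punchOut k≢l ,
      ≡.subst (λ i → a ≋ f i mod I) (≡.sym (Finₚ.punchIn-punchOut k≢l)) a≋fl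
      where
      k≢l : ¬ k ≡ l
      k≢l ≡.refl = a≉s (≋-trans I {a} {f k} {s} a≋fl (≋-sym I {s} s≋fk))

  -- If multiplication by w induces an isomorphism A/P → I/J, the classes mod J are g + w t,
  -- with g a class mod I and t a residue mod P.
  HasSizeMod-extend : ∀ (P I J : Ideal R) w {S : A → Set (c ⊔ ℓ)} {q m} → J ⊆ᴵ I → mem I w →
    (∀ x → mem P x → mem J (w * x)) → (∀ x → mem J (w * x) → mem P x) →
    (∀ x → mem I x → ∃ λ y → x ≋ w * y mod J) →
    HasSizeMod R (mem P) (λ _ → ⊤) q → (∀ {x y} → x ≋ y mod I → S y → S x) →
    HasSizeMod R (mem I) S m → HasSizeMod R (mem J) S (q ℕ.* m)
  HasSizeMod-extend P I J w {S} {q} {m} J⊆I w∈I P⇒J J⇒P generates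
                    (t , _ , t-inj , t-surj) S-stable (g , g∈S , g-inj , g-surj) =
    h ∘ Fin.remQuot m , (λ k → h∈S (Fin.remQuot m k)) , h-inj , h-surj
    where
    h : Fin q × Fin m → A
    h (i , j) = g j + w * t i

    h≋g : ∀ i j → h (i , j) ≋ g j mod I
    h≋g i j = ≋-intro I refl (resp I (*-comm (t i) w) (*-closed I (t i) w∈I))

    h∈S : ∀ p → S (h p)
    h∈S (i , j) = S-stable (h≋g i j) (g∈S j)

    h-inj′ : ∀ p p′ → h p ≋ h p′ mod J → p ≡ p′
    -- Reducing modulo `I` recovers `j`. Cancelling `g j` leaves `w * (t i - t i′)` in `J`, which
    -- `J⇒P` turns into a congruence modulo `P`.
    h-inj′ (i , j) (i′ , j′) h≋h′
      with g-inj j j′ (≋-trans I {g j} {h (i , j)} {g j′} (≋-sym I {h (i , j)} {g j} (h≋g i j))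
             (≋-trans I {h (i , j)} {h (i′ , j′)} {g j′} (J⊆I _ h≋h′) (h≋g i′ j′)))
    ... | ≡.refl with ≋-elim J {h (i , j)} {h (i′ , j)} h≋h′
    ... | e , e∈J , eq = ≡.cong (_, j) (t-inj i i′ (J⇒P _
      (resp J (sym (x[y-z]≈xy-xz w (t i) (t i′)))
        (≋-intro J {w * t i} {w * t i′} (+-cancelˡ (g j) _ _ (trans eq (+-assoc _ _ e))) e∈J))))

    h-inj : ∀ k k′ → h (Fin.remQuot m k) ≋ h (Fin.remQuot m k′) mod J → k ≡ k′
    h-inj k k′ h≋h′ = ≡.trans (≡.sym (Finₚ.combine-remQuot {q} m k))
      (≡.trans (≡.cong (λ p → Fin.combine (proj₁ p) (proj₂ p)) (h-inj′ (Fin.remQuot m k) (Fin.remQuot m k′) h≋h′))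
        (Finₚ.combine-remQuot {q} m k′))

    h-surj′ : ∀ a → S a → ∃ λ p → a ≋ h p mod J
    h-surj′ a a∈S with g-surj a a∈S
    ... | j , a≋gj with ≋-elim I {a} {g j} a≋gj
    ... | e , e∈I , a≈gj+e with generates e e∈I
    ... | y , e≋wy with ≋-elim J {e} {w * y} e≋wy | t-surj y _
    ... | d , d∈J , e≈wy+d | i , y≋ti with ≋-elim P {y} {t i} y≋ti
    ... | u , u∈P , y≈ti+u = (i , j) , ≋-intro J {a} {h (i , j)} (begin
      a                                ≈⟨ a≈gj+e ⟩
      g j + e                          ≈⟨ +-congˡ (trans e≈wy+d (+-congʳ (*-congˡ y≈ti+u))) ⟩
      g j + (w * (t i + u) + d)        ≈⟨ solve 5 (λ g w t u d →
                                            g :+ (w :* (t :+ u) :+ d) := g :+ w :* t :+ (w :* u :+ d))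
                                            refl (g j) w (t i) u d ⟩
      g j + w * t i + (w * u + d)      ∎) (+-closed J (P⇒J u u∈P) d∈J)

    h-surj : ∀ a → S a → ∃ λ k → a ≋ h (Fin.remQuot m k) mod J
    h-surj a a∈S with h-surj′ a a∈S
    ... | (i , j) , a≋h = Fin.combine i j ,
      ≡.subst (λ p → a ≋ h p mod J) (≡.sym (Finₚ.remQuot-combine i j)) a≋h

  -- Sieving out the classes of 0, -1, ..., -(r - 1).

  -- `L` with "unit" replaced by "outside `I`". For a nonzero prime P of a Dedekind domain these
  -- agree modulo every positive power of P, so one condition modulo P describes all the sets `L`.
  Sieve : Ideal R → ℕ → A → Set (c ⊔ ℓ)
  Sieve I r a = ∀ i → i ℕ.< r → ¬ mem I (a + ι R i)

  -- Equivalently, the integers 0, ..., r - 1 are pairwise incongruent modulo `I`.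
  NoSmallMultiple : Ideal R → ℕ → Set (c ⊔ ℓ)
  NoSmallMultiple I r = ∀ m → 0 ℕ.< m → m ℕ.< r → ¬ mem I (ι R m)

  -- If -r + i lay in `I` with i < r, so would the integer r - i, and 0 < r - i < r + 1. So the
  -- class of -r is still present after r stages of the sieve.
  -ι∈Sieve : ∀ I r → NoSmallMultiple I (suc r) → Sieve I r (- ι R r)
  -ι∈Sieve I r small i i<r -r+i∈I = small (r ℕ.∸ i) (ℕₚ.m<n⇒0<n∸m i<r) (s≤s (ℕₚ.m∸n≤m r i))
    (+-cancelˡ-mem I -r+i∈I (resp I (sym (begin
      (- ι R r + ι R i) + ι R (r ℕ.∸ i)   ≈⟨ +-assoc _ _ _ ⟩
      - ι R r + (ι R i + ι R (r ℕ.∸ i))   ≈⟨ +-congˡ (sym (ι-+ i (r ℕ.∸ i))) ⟩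
      - ι R r + ι R (i ℕ.+ (r ℕ.∸ i))     ≡⟨ ≡.cong (λ k → - ι R r + ι R k) (ℕₚ.m+[n∸m]≡n (ℕₚ.<⇒≤ i<r)) ⟩
      - ι R r + ι R r                     ≈⟨ -‿inverseˡ _ ⟩
      0#                                  ∎)) (zero∈ I)))

  -- Passing from r to r + 1 discards exactly one class, that of -r. Each removal finds a class to
  -- remove, so `pred` never acts on 0 and the truncated difference is a true one.
  Sieve-size : ∀ I {q} → HasSizeMod R (mem I) (λ _ → ⊤) q → ∀ r → NoSmallMultiple I r →
               HasSizeMod R (mem I) (Sieve I r) (q ℕ.∸ r)
  Sieve-size I size zero small = HasSizeMod-cong I I (λ _ → id) (λ _ → id) (λ _ _ _ ()) (λ _ _ → _) size
  Sieve-size I {q} size (suc r) small = ≡.subst (HasSizeMod R (mem I) (Sieve I (suc r))) (ℕₚ.pred[m∸n]≡m∸[1+n] q r)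
    (HasSizeMod-cong I I (λ _ → id) (λ _ → id)
      (λ { a (a∈ , a≉-r) i (s≤s i≤r) → [ a∈ i , (λ { ≡.refl → a≉-r ∘ resp I (a+r≈a--r a) }) ]′ (ℕₚ.m≤n⇒m<n∨m≡n i≤r) })
      (λ a a∈ → (λ i i<r → a∈ i (ℕₚ.m≤n⇒m≤1+n i<r)) , (λ a≋-r → a∈ r ℕₚ.≤-refl (resp I (sym (a+r≈a--r a)) a≋-r)))
      (HasSizeMod-remove I
        (Sieve-size I size r (λ m 0<m m<r → small m 0<m (ℕₚ.m≤n⇒m≤1+n m<r)))
        (-ι∈Sieve I r small)))
    where
    a+r≈a--r : ∀ a → a + ι R r ≈ a + - (- ι R r)
    a+r≈a--r a = +-congˡ (sym (-‿involutive _))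

  -- Modulo `I` the integer i agrees with `i % p`, so the first p conditions imply all the others.
  Sieve-periodic : ∀ I p .{{_ : ℕ.NonZero p}} → mem I (ι R p) → ∀ r a → Sieve I p a → Sieve I r a
  Sieve-periodic I p p∈I r a a∈ i _ a+i∈I = a∈ (i % p) (m%n<n i p)
    (+-cancelˡ-mem I (ι-*∈ I p∈I (i / p)) (resp I (begin
      a + ι R i                              ≡⟨ ≡.cong (λ k → a + ι R k) (m≡m%n+[m/n]*n i p) ⟩
      a + ι R (i % p ℕ.+ i / p ℕ.* p)        ≈⟨ +-congˡ (ι-+ (i % p) (i / p ℕ.* p)) ⟩
      a + (ι R (i % p) + ι R (i / p ℕ.* p))  ≈⟨ solve 3 (λ a x y → a :+ (x :+ y) := y :+ (a :+ x)) refl a _ _ ⟩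
      ι R (i / p ℕ.* p) + (a + ι R (i % p))  ∎) a+i∈I))

  Sieve-stable : ∀ I r {x y} → x ≋ y mod I → Sieve I r y → Sieve I r x
  Sieve-stable I r {x} {y} x≋y y∈ i i<r x+i∈I with ≋-elim I {x} {y} x≋y
  ... | e , e∈I , x≈y+e = y∈ i i<r (+-cancelˡ-mem I e∈I (resp I
    (trans (+-congʳ x≈y+e) (solve 3 (λ y e k → (y :+ e) :+ k := e :+ (y :+ k)) refl y e (ι R i))) x+i∈I))

  -- With no positive integer in `I`, sieving out q classes leaves none, yet the class of -q would
  -- survive.
  char-positive : ∀ I {q} → HasSizeMod R (mem I) (λ _ → ⊤) q → ¬ CharMod R (mem I) 0
  char-positive I {q} size char0 with Sieve-size I size q (λ m 0<m _ → char0 m 0<m)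
  ... | _ , _ , _ , surj with surj (- ι R q) (-ι∈Sieve I q (λ m 0<m _ → char0 m 0<m))
  ... | k , _ = Finₚ.¬Fin0 (≡.subst Fin (ℕₚ.n∸n≡0 q) k)

  CharMod⇒NoSmallMultiple : ∀ I p → CharMod R (mem I) p → NoSmallMultiple I p
  CharMod⇒NoSmallMultiple I (suc p) (_ , small) = small

  -- Iterated multiplication by a fraction.

  -- Read without denominators: `next` multiplies the value `v` by e/d, so i iterations multiply it
  -- by (e/d)^i.
  iterated-quotient : ∀ {b} {B : Set b} (v : B → A) (next : B → B) {d e} →
                      (∀ x → v x * e ≈ d * v (next x)) →
                      ∀ x i → e ↑ i * v x ≈ d ↑ i * v (fold x next i)
  iterated-quotient v next rel x zero = refl
  iterated-quotient v next {d} {e} rel x (suc i) = begin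
    e * e ↑ i * v x                          ≈⟨ *-assoc e (e ↑ i) (v x) ⟩
    e * (e ↑ i * v x)                        ≈⟨ *-congˡ (iterated-quotient v next rel x i) ⟩
    e * (d ↑ i * v (fold x next i))          ≈⟨ x∙yz≈y∙zx e (d ↑ i) _ ⟩
    d ↑ i * (v (fold x next i) * e)          ≈⟨ *-congˡ (rel (fold x next i)) ⟩
    d ↑ i * (d * v (next (fold x next i)))   ≈⟨ x∙yz≈yx∙z (d ↑ i) d _ ⟩
    d * d ↑ i * v (next (fold x next i))     ∎

  -- Cancellation, classical logic and ascending chains in a Dedekind domain.

  module _ (D : IsDedekindDomain R) where
    open IsDedekindDomain D

    *-cancelˡ : ∀ {x y z} → ¬ x ≈ 0# → x * y ≈ x * z → y ≈ z
    *-cancelˡ {x} {y} {z} x≉0 xy≈xz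
      with noZeroDivisors x (y + - z) (trans (x[y-z]≈xy-xz x y z) (trans (+-congʳ xy≈xz) (-‿inverseʳ _)))
    ... | inj₁ x≈0 = ⊥-elim (x≉0 x≈0)
    ... | inj₂ y-z≈0 = trans (x≈y+[x-y] y z) (trans (+-congˡ y-z≈0) (+-identityʳ z))

    -- Finding generators of {x | x ≈ 0 or Q} requires deciding Q.
    excluded-middle : (Q : Set (c ⊔ ℓ)) → Q ⊎ ¬ Q
    excluded-middle Q with noetherian I
      where
      I : Ideal R
      I = record
        { mem = λ x → x ≈ 0# ⊎ Q
        ; resp = λ { x≈y (inj₁ x≈0) → inj₁ (trans (sym x≈y) x≈0) ; _ (inj₂ q) → inj₂ q }
        ; zero∈ = inj₁ refl
        ; +-closed = λ { (inj₁ x≈0) (inj₁ y≈0) → inj₁ (trans (+-cong x≈0 y≈0) (+-identityˡ 0#))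
                       ; (inj₁ _) (inj₂ q) → inj₂ q ; (inj₂ q) _ → inj₂ q }
        ; *-closed = λ { r (inj₁ x≈0) → inj₁ (trans (*-congˡ x≈0) (zeroʳ r)) ; r (inj₂ q) → inj₂ q }
        }
    -- If all generators vanish the ideal is zero, whereas `Q` would put 1 into it.
    ... | gs , gen = [ inj₁ , (λ span≈0 → inj₂ λ q → 1≉0 (span≈0 1# (proj₁ (gen 1#) (inj₂ q)))) ]′
                       (decide gs λ x → proj₂ (gen x))
      where
      decide : ∀ gs → (∀ x → Span R gs x → x ≈ 0# ⊎ Q) → Q ⊎ (∀ x → Span R gs x → x ≈ 0#)
      decide [] _ = inj₂ λ _ → lower
      decide (g ∷ gs) h with h g (Span-head g gs) | decide gs (λ x → h x ∘ Span-tail g gs)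
      ... | inj₂ q   | _        = inj₁ q
      ... | inj₁ _   | inj₁ q   = inj₁ q
      ... | inj₁ g≈0 | inj₂ gs≈0 = inj₂ λ { x (a , y , y∈gs , x≈) →
        trans x≈ (trans (+-cong (trans (*-congˡ g≈0) (zeroʳ a)) (gs≈0 y y∈gs)) (+-identityˡ 0#)) }

    double-negation : ∀ {Q : Set (c ⊔ ℓ)} → ¬ ¬ Q → Q
    double-negation {Q} ¬¬q = [ id , (λ ¬q → ⊥-elim (¬¬q ¬q)) ]′ (excluded-middle Q)

    -- The union of the chain is finitely generated, and its finitely many generators all occur in a
    -- single `I N`.
    ascending-chain : (I : ℕ → Ideal R) → (∀ n → I n ⊆ᴵ I (suc n)) → ∃ λ N → ∀ n → I n ⊆ᴵ I N
    ascending-chain I I-suc with noetherian ⋃I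
      where
      ⋃I : Ideal R
      ⋃I = record
        { mem = λ x → ∃ λ n → mem (I n) x
        ; resp = λ { x≈y (n , x∈) → n , resp (I n) x≈y x∈ }
        ; zero∈ = 0 , zero∈ (I 0)
        ; +-closed = λ { (m , x∈) (n , y∈) → m ℕ.⊔ n ,
            +-closed (I (m ℕ.⊔ n)) (chain-mono I I-suc (ℕₚ.m≤m⊔n m n) _ x∈) (chain-mono I I-suc (ℕₚ.m≤n⊔m m n) _ y∈) }
        ; *-closed = λ { r (n , x∈) → n , *-closed (I n) r x∈ }
        }
    ... | gs , gen with bound gs (λ x → proj₂ (gen x))
      where
      bound : ∀ gs → (∀ x → Span R gs x → ∃ λ n → mem (I n) x) → ∃ λ N → All (mem (I N)) gs
      bound [] _ = 0 , []
      bound (g ∷ gs) h with h g (Span-head g gs) | bound gs (λ x → h x ∘ Span-tail g gs)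
      ... | m , g∈ | n , gs∈ = m ℕ.⊔ n ,
        chain-mono I I-suc (ℕₚ.m≤m⊔n m n) g g∈ ∷ All.map (chain-mono I I-suc (ℕₚ.m≤n⊔m m n) _) gs∈
    ... | N , gs∈ = N , λ n x x∈ → Span-least (I N) gs∈ x (proj₁ (gen x) (n , x∈))

    -- Almost integral fractions are integral.

    -- If z = Σ cᵢ f(i) over i < n and bⁱ w = v aⁱ f(i), then w (bⁿ − Σ cᵢ aⁿ⁻ⁱ bⁱ) = bⁿ w − v aⁿ z.
    hom-of-Span : ∀ a b n v w f z → (∀ i → b ↑ i * w ≈ v * a ↑ i * f i) → Span R (applyUpTo f n) z →
                  ∃ λ ks → length ks ≡ n × hom R ks b a * w + v * a ↑ n * z ≈ b ↑ n * w
    hom-of-Span a b zero v w f z rel (lift z≈0) = [] , ≡.refl ,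
      trans (+-congˡ (trans (*-congˡ z≈0) (zeroʳ _))) (+-identityʳ _)
    hom-of-Span a b (suc n) v w f z rel (k , y , y∈ , z≈)
      -- Dropping f(0) shifts the relation by one: a factor a moves into v and a factor b into w.
      with hom-of-Span a b n (v * a) (b * w) (f ∘ suc) y
             (λ i → trans (solve 3 (λ b bⁱ w → bⁱ :* (b :* w) := b :* bⁱ :* w) refl b (b ↑ i) w)
                     (trans (rel (suc i))
                       (solve 4 (λ v a aⁱ x → v :* (a :* aⁱ) :* x := v :* a :* aⁱ :* x) refl v a (a ↑ i) (f (suc i)))))
             y∈
    ... | ks , ≡.refl , ih = - k ∷ ks , ≡.refl , (begin
      (- k * a ↑ suc n + b * hom R ks b a) * w + v * a ↑ suc n * z
        ≈⟨ +-congˡ (*-congˡ z≈) ⟩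
      (- k * a ↑ suc n + b * hom R ks b a) * w + v * a ↑ suc n * (k * f 0 + y)
        ≈⟨ solve 10 (λ k⁻ k a aⁿ b h w v x y →
             (k⁻ :* (a :* aⁿ) :+ b :* h) :* w :+ v :* (a :* aⁿ) :* (k :* x :+ y)
             := a :* aⁿ :* (k⁻ :* (con 1 :* w) :+ k :* (v :* con 1 :* x)) :+ (h :* (b :* w) :+ v :* a :* aⁿ :* y))
             refl (- k) k a (a ↑ n) b (hom R ks b a) w v (f 0) y ⟩
      a ↑ suc n * (- k * (1# * w) + k * (v * 1# * f 0)) + (hom R ks b a * (b * w) + v * a * a ↑ n * y)
        -- The terms in k cancel, since `rel 0` says w = v f(0).
        ≈⟨ +-cong (*-congˡ (trans (+-congˡ (*-congˡ (sym (rel 0)))) (trans (sym (distribʳ _ (- k) k))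
             (trans (*-congʳ (-‿inverseˡ k)) (zeroˡ _))))) ih ⟩
      a ↑ suc n * 0# + b ↑ n * (b * w)
        ≈⟨ solve 4 (λ A bⁿ b w → A :* con 0 :+ bⁿ :* (b :* w) := b :* bⁿ :* w) refl (a ↑ suc n) (b ↑ n) b w ⟩
      b ↑ suc n * w ∎)

    -- The `f i` are the elements w(b/a)^i, all in R. The ideals they span stabilise, so some `f N`
    -- is a combination of its predecessors, and cancelling w leaves a monic equation for b/a.
    almost-integral⇒integral : ∀ {a b w} (f : ℕ → A) → ¬ a ≈ 0# → ¬ w ≈ 0# →
                               (∀ i → b ↑ i * w ≈ a ↑ i * f i) → ∃ λ x → b ≈ x * a
    almost-integral⇒integral {a} {b} {w} f a≉0 w≉0 rel
      with ascending-chain (λ n → Span-ideal (applyUpTo f n)) (λ n x → Span-applyUpTo-suc f n)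
    ... | N , stable
      with hom-of-Span a b N 1# w f (f N) (λ i → trans (rel i) (*-congʳ (sym (*-identityˡ _))))
             (stable (suc N) (f N) (Span-applyUpTo-last f N))
    ... | ks , _ , eq = integrallyClosed b a a≉0 ks
      ([ id , (λ w≈0 → ⊥-elim (w≉0 w≈0)) ]′ (noZeroDivisors _ w hom*w≈0))
      where
      hom*w≈0 : hom R ks b a * w ≈ 0#
      hom*w≈0 = +-cancelʳ (b ↑ N * w) _ _ (trans (+-congˡ (trans (rel N) (*-congʳ (sym (*-identityˡ _)))))
        (trans eq (sym (+-identityˡ _))))

    -- Maximal members of families of ideals, and primes as ideal quotients.

    -- A sequence that moves to a strictly larger ideal whenever there is one must stall, by
    -- `ascending-chain`; where it stalls there is nothing larger.
    maximal-condition : {B : Set (c ⊔ ℓ)} (J : B → Ideal R) → B → ∃ λ b → ∀ b′ → J b ⊆ᴵ J b′ → J b′ ⊆ᴵ J b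
    maximal-condition {B} J b₀ = bs N , maximal
      where
      Larger : B → Set (c ⊔ ℓ)
      Larger b = ∃ λ b′ → J b ⊆ᴵ J b′ × ∃ λ z → mem (J b′) z × ¬ mem (J b) z

      -- The decision is an argument, so that facts about `next` follow by matching on it.
      next : ∀ b → Larger b ⊎ ¬ Larger b → B
      next b (inj₁ (b′ , _)) = b′
      next b (inj₂ _) = b

      next-⊇ : ∀ b d → J b ⊆ᴵ J (next b d)
      next-⊇ b (inj₁ (_ , ⊆b′ , _)) = ⊆b′
      next-⊇ b (inj₂ _) x x∈ = x∈

      next-⊆⇒¬Larger : ∀ b d → J (next b d) ⊆ᴵ J b → ¬ Larger b
      next-⊆⇒¬Larger b (inj₁ (_ , _ , z , z∈ , z∉)) next⊆ = λ _ → z∉ (next⊆ z z∈)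
      next-⊆⇒¬Larger b (inj₂ none) next⊆ = none

      bs : ℕ → B
      bs zero = b₀
      bs (suc n) = next (bs n) (excluded-middle _)

      chain : ∃ λ N → ∀ n → J (bs n) ⊆ᴵ J (bs N)
      chain = ascending-chain (J ∘ bs) (λ n → next-⊇ (bs n) (excluded-middle _))

      N : ℕ
      N = proj₁ chain

      maximal : ∀ b′ → J (bs N) ⊆ᴵ J b′ → J b′ ⊆ᴵ J (bs N)
      maximal b′ ⊆b′ z z∈ = double-negation λ z∉ →
        next-⊆⇒¬Larger (bs N) (excluded-middle _) (proj₂ chain (suc N)) (b′ , ⊆b′ , z , z∈ , z∉)

    module _ (P : Ideal R) (P-prime : IsPrimeIdeal R P) where

      ↑-∉ : ∀ {s} → ¬ mem P s → ∀ n → ¬ mem P (s ↑ n)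
      ↑-∉ s∉P zero = proj₁ P-prime
      ↑-∉ s∉P (suc n) s^n∈P = [ s∉P , ↑-∉ s∉P n ]′ (proj₂ P-prime _ _ s^n∈P)

      -- Let xy lie in Q = (a : b), so x lies in (a : by). If that ideal is inside P, maximality
      -- puts x in Q. Otherwise it contains some t outside P, and y lies in (a : bt). This ideal is
      -- inside P, because v in it gives vt in Q, hence v in P; maximality then puts y in Q.
      maximal-colon-prime : ∀ {a b} → colon a b ⊆ᴵ P →
        (∀ t → colon a b ⊆ᴵ colon a (b * t) → colon a (b * t) ⊆ᴵ P → colon a (b * t) ⊆ᴵ colon a b) →
        IsPrimeIdeal R (colon a b)
      maximal-colon-prime {a} {b} Q⊆P Q-maximal = proj₁ P-prime ∘ Q⊆P 1# , primality
        where
        Q : Ideal R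
        Q = colon a b

        Q⊆ : ∀ t → Q ⊆ᴵ colon a (b * t)
        Q⊆ t z (y , zb≈ay) = y * t , trans (sym (*-assoc z b t)) (trans (*-congʳ zb≈ay) (*-assoc a y t))

        primality : ∀ x y → mem Q (x * y) → mem Q x ⊎ mem Q y
        primality x y (z , xyb≈az) with excluded-middle (∃ λ t → mem (colon a (b * y)) t × ¬ mem P t)
        ... | inj₂ none = inj₁ (Q-maximal y (Q⊆ y)
              (λ t t∈ → double-negation λ t∉P → none (t , t∈ , t∉P)) x
              (z , trans (x∙yz≈xz∙y x b y) xyb≈az))
        ... | inj₁ (t , (u , tby≈au) , t∉P) = inj₂ (Q-maximal t (Q⊆ t)
              (λ { v (w , vbt≈aw) → [ id , (λ t∈P → ⊥-elim (t∉P t∈P)) ]′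
                (proj₂ P-prime v t (Q⊆P (v * t) (w , trans (sym (x∙yz≈xz∙y v b t)) vbt≈aw))) }) y
              (u , trans (x∙yz≈z∙yx y b t) tby≈au))

      -- Among the ideals (a : b) contained in P, a maximal one is prime, hence equal to P.
      colon-equal-to-prime : ∀ {a} → ¬ a ≈ 0# → mem P a →
                             ∃ λ b → colon a b ⊆ᴵ P × P ⊆ᴵ colon a b
      colon-equal-to-prime {a} a≉0 a∈P with maximal-condition (colon a ∘ proj₁) one
        where
        -- The search starts at (a : 1) = (a), which lies in P.
        one : Σ A λ b → colon a b ⊆ᴵ P
        one = 1# , λ { z (y , z≈) →
          resp P (trans (*-comm y a) (trans (sym z≈) (*-identityʳ z))) (*-closed P y a∈P) }
      ... | (b , Q⊆P) , Q-maximal = b , Q⊆P , λ z z∈P → double-negation λ z∉Q →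
        -- (a : b) contains a ≠ 0, so it is a maximal ideal; an element of P outside it would force
        -- 1 into P.
        proj₁ P-prime (proj₂ (nonzeroPrime⇒maximal (colon a b)
          (maximal-colon-prime Q⊆P λ t Q⊆ ⊆P → Q-maximal (b * t , ⊆P) Q⊆) (a , (b , refl) , a≉0))
          P Q⊆P (z , z∈P , z∉Q))

      -- A uniformizer at P.

      -- `π` generates the maximal ideal of the localisation at P, where `s` becomes a unit; `P*s⊆π`
      -- is this with the denominator cleared.
      record Uniformizer : Set (c ⊔ ℓ) where
        field
          π s : A
          π≉0 : ¬ π ≈ 0#
          π∈P : mem P π
          s∉P : ¬ mem P s
          P*s⊆π : ∀ x → mem P x → ∃ λ y → x * s ≈ π * y

      uniformizer : IsNonzero R P → Uniformizer
      uniformizer (a , a∈P , a≉0) with colon-equal-to-prime a≉0 a∈P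
      ... | b , colon⊆P , P⊆colon
        -- Such a pair, s = (b/a)π, witnesses that (b/a)P is not inside P.
        with excluded-middle (∃ λ π → ∃ λ s → mem P π × ¬ mem P s × π * b ≈ a * s)
      ... | inj₁ (π , s , π∈P , s∉P , πb≈as) = record
        { π = π ; s = s ; π∈P = π∈P ; s∉P = s∉P
        ; π≉0 = λ π≈0 → s∉P (resp P (sym (*-cancelˡ a≉0
            (trans (sym πb≈as) (trans (*-congʳ π≈0) (trans (zeroˡ b) (sym (zeroʳ a))))))) (zero∈ P))
        ; P*s⊆π = λ x x∈P → let y , xb≈ay = P⊆colon x x∈P in y , *-cancelˡ a≉0 (begin
            a * (x * s)   ≈⟨ x∙yz≈y∙xz a x s ⟩
            x * (a * s)   ≈⟨ *-congˡ πb≈as ⟨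
            x * (π * b)   ≈⟨ x∙yz≈y∙xz x π b ⟩
            π * (x * b)   ≈⟨ *-congˡ xb≈ay ⟩
            π * (a * y)   ≈⟨ x∙yz≈y∙xz π a y ⟩
            a * (π * y)   ∎)
        }
      -- Otherwise b/a maps P into itself, so every a(b/a)^i lies in R and b/a is integral. Then b =
      -- xa with x in R, which puts 1 in (a : b), inside P.
      ... | inj₂ none
        with almost-integral⇒integral (λ i → proj₁ (fold (a , a∈P) quotient i)) a≉0 a≉0
               (iterated-quotient proj₁ quotient (λ { (z , z∈P) → proj₂ (P⊆colon z z∈P) }) (a , a∈P))
        where
        quotient : Σ A (mem P) → Σ A (mem P)
        quotient (z , z∈P) = proj₁ (P⊆colon z z∈P) ,
          double-negation λ y∉P → none (z , _ , z∈P , y∉P , proj₂ (P⊆colon z z∈P))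
      ... | x , b≈xa = ⊥-elim (proj₁ P-prime (colon⊆P 1#
        (x , trans (*-identityˡ b) (trans b≈xa (*-comm x a)))))

      -- Units modulo powers of P.

      module _ (P-nonzero : IsNonzero R P) where
        -- By maximality P + (x) contains 1. The error `e` stays explicit, so that later identities
        -- are free of subtraction and within reach of the semiring solver.
        inverse-mod-P : ∀ {x} → ¬ mem P x → ∃₂ λ y e → mem P e × x * y + e ≈ 1#
        inverse-mod-P {x} x∉P
          with proj₂ (nonzeroPrime⇒maximal P P-prime P-nonzero) P+x
                 (λ e e∈P → 0# , e , e∈P , solve 2 (λ e x → e := x :* con 0 :+ e) refl e x)
                 (x , (1# , 0# , zero∈ P , solve 1 (λ x → x := x :* con 1 :+ con 0) refl x) , x∉P)
          where
          P+x : Ideal R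
          P+x = record
            { mem = λ z → ∃₂ λ y e → mem P e × z ≈ x * y + e
            ; resp = λ { z≈z′ (y , e , e∈P , z≈) → y , e , e∈P , trans (sym z≈z′) z≈ }
            ; zero∈ = 0# , 0# , zero∈ P , solve 1 (λ x → con 0 := x :* con 0 :+ con 0) refl x
            ; +-closed = λ { (y , e , e∈P , z≈) (y′ , e′ , e′∈P , z′≈) → y + y′ , e + e′ , +-closed P e∈P e′∈P ,
                trans (+-cong z≈ z′≈) (solve 5 (λ x y e y′ e′ →
                  (x :* y :+ e) :+ (x :* y′ :+ e′) := x :* (y :+ y′) :+ (e :+ e′)) refl x y e y′ e′) }
            ; *-closed = λ { r (y , e , e∈P , z≈) → r * y , r * e , *-closed P r e∈P ,
                trans (*-congˡ z≈) (solve 4 (λ x y e r → r :* (x :* y :+ e) := x :* (r :* y) :+ r :* e) refl x y e r) }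
            }
        ... | y , e , e∈P , 1≈ = y , e , e∈P , sym 1≈

        -- Expand (xy + e)(xz + d) = 1: every term except ed has a factor x, and ed lies in the next
        -- power of P.
        inverse-mod-pow : ∀ {x} → ¬ mem P x → ∀ n → ∃₂ λ y e → mem (pow P n) e × x * y + e ≈ 1#
        inverse-mod-pow {x} x∉P zero = 0# , 1# , _ , solve 1 (λ x → x :* con 0 :+ con 1 := con 1) refl x
        inverse-mod-pow {x} x∉P (suc n) with inverse-mod-P x∉P | inverse-mod-pow x∉P n
        ... | y , e , e∈P , xy+e≈1 | z , d , d∈Pⁿ , xz+d≈1 =
          y * (x * z + d) + e * z , e * d , ·ᴵ-intro e∈P d∈Pⁿ ,
          trans (solve 5 (λ x y e z d →
                  x :* (y :* (x :* z :+ d) :+ e :* z) :+ e :* d := (x :* y :+ e) :* (x :* z :+ d)) refl x y e z d)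
                (trans (*-cong xy+e≈1 xz+d≈1) (*-identityˡ 1#))

        ∉⇒unit-mod-pow : ∀ n {x} → ¬ mem P x → IsUnitMod R (mem (pow P n)) x
        ∉⇒unit-mod-pow n x∉P with inverse-mod-pow x∉P n
        ... | y , e , e∈Pⁿ , xy+e≈1 = y , ≋-sym (pow P n) (≋-intro (pow P n) (sym xy+e≈1) e∈Pⁿ)

        -- The exponent is positive because modulo the zeroth power, the whole ring, every element
        -- is a unit.
        unit-mod-pow⇒∉ : ∀ n {x} → IsUnitMod R (mem (pow P (suc n))) x → ¬ mem P x
        unit-mod-pow⇒∉ n {x} (y , xy≋1) x∈P with ≋-elim P (≋-sym P {x * y} {1#} (pow-suc⊆ P n _ xy≋1))
        ... | e , e∈P , 1≈xy+e = proj₁ P-prime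
          (resp P (sym 1≈xy+e) (+-closed P (resp P (*-comm y x) (*-closed P y x∈P)) e∈P))

        -- Successive quotients of the powers of P, and lifting of counts.

        module _ (U : Uniformizer) where
          open Uniformizer U

          -- Each of the n factors from P absorbs one `s` and yields one `π`.
          pow⊆colon : ∀ n → pow P n ⊆ᴵ colon (π ↑ n) (s ↑ n)
          pow⊆colon zero x _ = x , *-comm x 1#
          pow⊆colon (suc n) x = ·ᴵ-least (colon (π ↑ suc n) (s ↑ suc n)) λ {a} {b} a∈P b∈Pⁿ →
            let a′ , as≈πa′ = P*s⊆π a a∈P
                b′ , bsⁿ≈πⁿb′ = pow⊆colon n b b∈Pⁿ
            in a′ * b′ , (begin
              a * b * (s * s ↑ n)        ≈⟨ interchange a b s (s ↑ n) ⟩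
              a * s * (b * s ↑ n)        ≈⟨ *-cong as≈πa′ bsⁿ≈πⁿb′ ⟩
              π * a′ * (π ↑ n * b′)      ≈⟨ interchange π a′ (π ↑ n) b′ ⟩
              π * π ↑ n * (a′ * b′)      ∎)

          -- Surjectivity of R/P → P^n/P^(n+1). Multiplying x by 1 = s^n u + e turns x s^n into a
          -- multiple of π^n and leaves ex in P^(n+1).
          pow-generated : ∀ n {x} → mem (pow P n) x → ∃ λ y → x ≋ π ↑ n * y mod pow P (suc n)
          pow-generated n {x} x∈Pⁿ with pow⊆colon n x x∈Pⁿ | inverse-mod-P (↑-∉ s∉P n)
          ... | y , xsⁿ≈πⁿy | u , e , e∈P , sⁿu+e≈1 = y * u , ≋-intro (pow P (suc n)) (begin
              x                          ≈⟨ *-identityʳ x ⟨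
              x * 1#                     ≈⟨ *-congˡ sⁿu+e≈1 ⟨
              x * (s ↑ n * u + e)        ≈⟨ solve 4 (λ x t u e → x :* (t :* u :+ e) := x :* t :* u :+ e :* x) refl x (s ↑ n) u e ⟩
              x * s ↑ n * u + e * x      ≈⟨ +-congʳ (trans (*-congʳ xsⁿ≈πⁿy) (*-assoc _ y u)) ⟩
              π ↑ n * (y * u) + e * x    ∎) (·ᴵ-intro e∈P x∈Pⁿ)

          π↑≉0 : ∀ n → ¬ π ↑ n ≈ 0#
          π↑≉0 zero = 1≉0
          π↑≉0 (suc n) eq = [ π≉0 , π↑≉0 n ]′ (noZeroDivisors _ _ eq)

          -- Injectivity of the same map: cancelling π^n from π^n x s^(n+1) = π^(n+1) y puts x
          -- s^(n+1) in P, while s is outside P.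
          pow-suc-cancel : ∀ n {x} → mem (pow P (suc n)) (π ↑ n * x) → mem P x
          pow-suc-cancel n {x} πⁿx∈ with pow⊆colon (suc n) _ πⁿx∈
          ... | y , eq = [ id , (λ s∈ → ⊥-elim (↑-∉ s∉P (suc n) s∈)) ]′ (proj₂ P-prime x (s ↑ suc n)
            (resp P (sym (*-cancelˡ (π↑≉0 n) (begin
              π ↑ n * (x * s ↑ suc n)   ≈⟨ *-assoc _ _ _ ⟨
              π ↑ n * x * s ↑ suc n     ≈⟨ eq ⟩
              π * π ↑ n * y             ≈⟨ solve 3 (λ π t y → π :* t :* y := t :* (y :* π)) refl π (π ↑ n) y ⟩
              π ↑ n * (y * π)           ∎))) (*-closed P y π∈P)))

          lift-size : ∀ {S : A → Set (c ⊔ ℓ)} {q} → HasSizeMod R (mem P) (λ _ → ⊤) q →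
                      (∀ {x y} → x ≋ y mod P → S y → S x) →
                      ∀ n {m} → HasSizeMod R (mem (pow P (suc n))) S m →
                      HasSizeMod R (mem (pow P (suc (suc n)))) S (q ℕ.* m)
          lift-size residues S-stable n = HasSizeMod-extend P (pow P (suc n)) (pow P (suc (suc n))) (π ↑ suc n)
            (pow-suc⊆pow P (suc n)) (↑∈pow P (suc n) π∈P)
            (λ x x∈P → resp (pow P (suc (suc n))) (*-comm x _) (·ᴵ-intro x∈P (↑∈pow P (suc n) π∈P)))
            (λ x → pow-suc-cancel (suc n)) (λ x → pow-generated (suc n))
            residues (λ x≋y → S-stable (pow-suc⊆ P n _ x≋y))

          -- `S` is a union of classes modulo P. The induction starts at exponent 1, and each
          -- further exponent splits every class into q.
          lift-size-pow : ∀ {S : A → Set (c ⊔ ℓ)} {q m} → HasSizeMod R (mem P) (λ _ → ⊤) q →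
                          (∀ {x y} → x ≋ y mod P → S y → S x) → HasSizeMod R (mem P) S m →
                          ∀ n → HasSizeMod R (mem (pow P (suc n))) S (q ℕ.^ n ℕ.* m)
          lift-size-pow {S} {q} {m} residues S-stable size zero =
            ≡.subst (HasSizeMod R (mem (pow P 1)) S) (≡.sym (ℕₚ.*-identityˡ m))
              (HasSizeMod-cong P (pow P 1) (⊆pow-1 P) (pow-suc⊆ P 0) (λ _ → id) (λ _ → id) size)
          lift-size-pow {S} {q} {m} residues S-stable size (suc n) =
            ≡.subst (HasSizeMod R (mem (pow P (suc (suc n)))) S) (≡.sym (ℕₚ.*-assoc q (q ℕ.^ n) m))
              (lift-size residues S-stable n (lift-size-pow residues S-stable size n))

          L-size : ∀ {q m} r → HasSizeMod R (mem P) (λ _ → ⊤) q → HasSizeMod R (mem P) (Sieve P r) m → ∀ n →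
                   HasSizeMod R (_^ᴵ_ R (mem P) (suc n)) (L R r (_^ᴵ_ R (mem P) (suc n))) (q ℕ.^ n ℕ.* m)
          L-size {q} {m} r residues size n =
            ≡.subst (λ I → HasSizeMod R I (L R r I) (q ℕ.^ n ℕ.* m)) (mem-pow P (suc n))
              (HasSizeMod-cong (pow P (suc n)) (pow P (suc n)) (λ _ → id) (λ _ → id)
                (λ a a∈ i i<r → ∉⇒unit-mod-pow (suc n) (a∈ i i<r))
                (λ a a∈ i i<r → unit-mod-pow⇒∉ n (a∈ i i<r))
                (lift-size-pow residues (Sieve-stable P r) size n))

-- The count for r up to the characteristic and for r beyond it.

open import Data.Nat using (_<_; _≤_; _^_; _∸_; _*_)

theorem2p2 : ∀ {c ℓ} (R : CommutativeRing c ℓ) → IsDedekindDomain R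
    → (P : Ideal R) → IsPrimeIdeal R P → IsNonzero R P
    → (q : ℕ) → HasSizeMod R (mem P) (λ _ → ⊤) q
    → (p : ℕ) → CharMod R (mem P) p
    → (r α : ℕ) → 0 < r → 0 < α
    → (r ≤ p → HasSizeMod R (_^ᴵ_ R (mem P) α) (L R r (_^ᴵ_ R (mem P) α)) (q ^ (α ∸ 1) * (q ∸ r)))
    × (p < r → HasSizeMod R (_^ᴵ_ R (mem P) α) (L R r (_^ᴵ_ R (mem P) α)) (q ^ (α ∸ 1) * (q ∸ p)))
-- `0 < α` forces α = n + 1, so `α ∸ 1` is n.
theorem2p2 R D P P-prime P-nonzero q residues p char-p r (suc n) 0<r 0<α =
  (λ r≤p → L-size R D P P-prime P-nonzero U r residues
    (Sieve-size R P residues r (λ m 0<m m<r → small m 0<m (ℕₚ.<-≤-trans m<r r≤p))) n) ,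
  -- Beyond p the conditions repeat, so the sieves of lengths r and p select the same classes.
  λ p<r → L-size R D P P-prime P-nonzero U r residues
    (HasSizeMod-cong R P P (λ _ → id) (λ _ → id) (above p char-p) (λ a a∈ i i<p → a∈ i (ℕₚ.<-trans i<p p<r))
      (Sieve-size R P residues p small)) n
  where
  U = uniformizer R D P P-prime P-nonzero

  small : NoSmallMultiple R P p
  small = CharMod⇒NoSmallMultiple R P p char-p

  above : ∀ p → CharMod R (mem P) p → ∀ a → Sieve R P p a → Sieve R P r a
  -- `CharMod` encodes characteristic zero by p = 0, which the finiteness of R/P excludes.
  above zero char0 = ⊥-elim (char-positive R P residues char0)
  above (suc p) (p∈P , _) = Sieve-periodic R P (suc p) p∈P r
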